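{- For every spanning forest $F$ of $G$, every square minor of $B_F$ belongs to $\{0,+1,-1\}$. In particular, if $F$ has $s$ connected components and $S\subseteq N$ has $|S|=s-1$, then $\chi_F(S)\in\{0,+1,-1\}$, and $\chi_F(S)\neq0$ if and only if the quotient edges in $S$ form a spanning tree of $H_F$.
   Context: Network. $G=(V,E)$ is a finite connected simple undirected graph. A spanning forest $F$ of $G$ is an acyclic subgraph with vertex set $V$ (isolated vertices allowed). Matrix conventions. $A[S,T]$ is the submatrix with rows $S$ and columns $T$ in inherited order; $A[:,T]$ keeps all rows; empty determinants equal $1$. Superports. The boundary $M\subseteq V$ is nonempty and partitioned into nonempty superports $M=A_1\sqcup\cdots\sqcup A_p$. Choose a root $r_a\in A_a$ for each $a$; $R=\{r_1,\dots,r_p\}$, $N=M\setminus R$, $q=|N|$, $N=(x_1,\dots,x_q)$ in a fixed order; $r(x)$ is the root of the superport containing $x$. Fix a ground root $g\in R$. In $\mathbb R^{V\setminus\{g\}}$ with standard basis $(e_v)$ and the convention $e_g=0$, let $D$ be the matrix whose columns are $d_x=e_x-e_{r(x)}$, $x\in N$, in the fixed order. Quotient port graph. For a spanning forest $F$ with $s\ge1$ components, let $C_0(F)$ be the component containing $g$ and order the others as $C_1(F),\dots,C_{s-1}(F)$. The quotient port multigraph $H_F$ has the components of $F$ as vertices, and each $x\in N$ gives a directed edge (the quotient edge of $x$) from the component containing $r(x)$ to the component containing $x$ (a loop if these coincide). Let $Q_F$ be the $(s-1)\times(|V|-1)$ matrix with columns indexed by $V\setminus\{g\}$ and $(Q_F)_{a,v}=1$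 if $v\in C_a(F)$, $0$ otherwise ($1\le a\le s-1$), and $B_F=Q_FD$. For $S\subseteq N$ with $|S|=s-1$, $\chi_F(S)=\det B_F[:,S]$, with $\chi_F(\varnothing)=1$ when $s=1$. -}

module Defs where

open import Algebra.Definitions.RawMonoid using (sum)
open import Data.Bool.Base using (if_then_else_)
open import Data.Fin.Base using (Fin; zero; suc; toℕ; cast; punchIn)
open import Data.Fin.Properties using (_≟_)
open import Data.Fin.Subset using (Subset; inside; outside; _∈_; ∣_∣; Nonempty)
open import Data.Integer.Base
  using (ℤ; 0ℤ; 1ℤ; -1ℤ; +-0-rawMonoid; _-_; _*_; _^_)
open import Data.List.Base using (List; []; _∷_; length)
open import Data.List.Relation.Unary.Unique.Propositional using (Unique)
open import Data.Nat.Base using (ℕ; zero; suc; _≤_)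
open import Data.Product.Base using (∃-syntax; _×_; _,_; proj₁)
open import Data.Sum.Base using (_⊎_)
open import Data.Vec.Base using ([]; _∷_)
open import Data.Vec.Functional using (Vector)
open import Function.Bundles using (_⇔_; module Equivalence)
open import Function.Definitions using (Injective)
open import Level using (0ℓ)
open import Relation.Binary.Construct.Closure.ReflexiveTransitive
  using (Star; ε; _◅_)
open import Relation.Binary.Core using (Rel)
open import Relation.Binary.Definitions using (Symmetric; Decidable)
open import Relation.Binary.PropositionalEquality.Core
  using (_≡_; refl; sym)
open import Relation.Nullary using (Dec; does; ¬_)

-- All matrices in question have integer entries, so ℤ stands in for ℝ.
Matrix : ℕ → ℕ → Set
Matrix m n = Vector (Vector ℤ n) m

∑ : ∀ {n} → Vector ℤ n → ℤ
∑ = sum +-0-rawMonoid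

infixl 7 _⊗_

_⊗_ : ∀ {l m n} → Matrix l m → Matrix m n → Matrix l n
(A ⊗ B) i k = ∑ λ j → A i j * B j k

-- Laplace expansion along the first row.
det : ∀ {n} → Matrix n n → ℤ
det {zero}  A = 1ℤ
det {suc n} A =
  ∑ λ j → -1ℤ ^ toℕ j * A zero j * det (λ i k → A (suc i) (punchIn j k))

-- The elements of a subset, in increasing order.
elements : ∀ {n} (S : Subset n) → Fin ∣ S ∣ → Fin n
elements (inside  ∷ S) zero    = zero
elements (inside  ∷ S) (suc i) = suc (elements S i)
elements (outside ∷ S) i       = suc (elements S i)

minor : ∀ {m n} → Matrix m n →
        (T : Subset m) (S : Subset n) → ∣ T ∣ ≡ ∣ S ∣ → ℤ
minor A T S eq = det λ i j → A (elements T i) (elements S (cast eq j))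

maximalMinor : ∀ {m n} → Matrix m n → (S : Subset n) → ∣ S ∣ ≡ m → ℤ
maximalMinor A S eq = det λ i j → A i (elements S (cast (sym eq) j))

data _∈0±1 (z : ℤ) : Set where
  is0  : z ≡ 0ℤ  → z ∈0±1
  is+1 : z ≡ 1ℤ  → z ∈0±1
  is-1 : z ≡ -1ℤ → z ∈0±1

𝟙 : ∀ {P : Set} → Dec P → ℤ
𝟙 P? = if does P? then 1ℤ else 0ℤ

record Graph (n : ℕ) : Set₁ where
  field
    Adj     : Rel (Fin n) 0ℓ
    adj?    : Decidable Adj
    adj-sym : Symmetric Adj
    no-loop : ∀ {v} → ¬ Adj v v

  Walk : Rel (Fin n) 0ℓ
  Walk = Star Adj

-- The vertices visited by a walk, except for its endpoint; for a closed walk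
-- this lists the base point exactly once.
vertices : ∀ {A : Set} {T : Rel A 0ℓ} {u v} → Star T u v → List A
vertices ε                 = []
vertices (_◅_ {i = u} _ w) = u ∷ vertices w

module _ {n} (G : Graph n) where
  open Graph G

  Connected : Set
  Connected = ∀ u v → Walk u v

  IsCycle : ∀ {v} → Walk v v → Set
  IsCycle w = 3 ≤ length (vertices w) × Unique (vertices w)

  Acyclic : Set
  Acyclic = ∀ {v} (w : Walk v v) → ¬ IsCycle w

record IsSpanningForest {n} (G F : Graph n) : Set where
  field
    subgraph : ∀ {u v} → Graph.Adj F u v → Graph.Adj G u v
    acyclic  : Acyclic F

-- An ordering C₀, …, Cₖ of the components of F with g ∈ C₀, given by the map
-- sending each vertex to the index of its component; F has suc k components.
record ComponentOrder {n} (F : Graph n) (g : Fin n) (k : ℕ) : Set where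
  field
    comp       : Fin n → Fin (suc k)
    surjective : ∀ a → ∃[ v ] comp v ≡ a
    connected  : ∀ u v → comp u ≡ comp v ⇔ Graph.Walk F u v
    ground     : comp g ≡ zero

-- Edges are directed, but walks, cycles and trees ignore the directions.
record Multigraph (n e : ℕ) : Set where
  field
    source target : Fin e → Fin n

module _ {n e} (H : Multigraph n e) (S : Subset e) where
  open Multigraph H

  Joins : Fin e → Rel (Fin n) 0ℓ
  Joins x u v = (source x ≡ u × target x ≡ v) ⊎ (source x ≡ v × target x ≡ u)

  Step : Rel (Fin n) 0ℓ
  Step u v = ∃[ x ] (x ∈ S × Joins x u v)

  edges : ∀ {u v} → Star Step u v → List (Fin e)
  edges ε       = []
  edges (s ◅ w) = proj₁ s ∷ edges w

  -- Loops and pairs of parallel edges are cycles, of lengths one and two.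
  IsEdgeCycle : ∀ {v} → Star Step v v → Set
  IsEdgeCycle w =
    1 ≤ length (edges w) × Unique (edges w) × Unique (vertices w)

  record IsSpanningTree : Set where
    field
      connected : ∀ u v → Star Step u v
      acyclic   : ∀ {v} (w : Star Step v v) → ¬ IsEdgeCycle w

-- A partition A₁, …, Aₚ of the boundary M with a root in each part, a ground
-- root g, and an enumeration x₁, …, x_q of N = M ∖ R, where R is the set of
-- roots; r i is the root of the part containing x i.
record Superports (n : ℕ) : Set where
  field
    M          : Subset n
    M-nonempty : Nonempty M

    p          : ℕ
    A          : Fin p → Subset n
    A-nonempty : ∀ a → Nonempty (A a)
    A-disjoint : ∀ {a b v} → v ∈ A a → v ∈ A b → a ≡ b
    A-cover    : ∀ v → v ∈ M ⇔ (∃[ a ] v ∈ A a)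

    root       : Fin p → Fin n
    root∈A     : ∀ a → root a ∈ A a
    ground     : Fin p

  InR : Fin n → Set
  InR v = ∃[ a ] root a ≡ v

  InN : Fin n → Set
  InN v = v ∈ M × ¬ InR v

  g : Fin n
  g = root ground

  field
    q           : ℕ
    x           : Fin q → Fin n
    x-injective : Injective _≡_ _≡_ x
    x-image     : ∀ v → (∃[ i ] x i ≡ v) ⇔ InN v

  port : Fin q → Fin p
  port i = proj₁ (to (A-cover (x i)) (proj₁ (to (x-image (x i)) (i , refl))))
    where open Equivalence

  r : Fin q → Fin n
  r i = root (port i)

-- Subsets of N are represented by subsets of the index set Fin q, and
-- V ∖ {g} is indexed by Fin m through punchIn g.
module _ {m} (P : Superports (suc m)) where
  open Superports P

  -- In particular e g = 0, since punchIn g avoids g.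
  e : Fin (suc m) → Vector ℤ m
  e v j = 𝟙 (punchIn g j ≟ v)

  D : Matrix m q
  D j i = e (x i) j - e (r i) j

  module _ {F : Graph (suc m)} {k} (C : ComponentOrder F g k) where
    open ComponentOrder C using (comp)

    quotientGraph : Multigraph (suc k) q
    quotientGraph = record
      { source = λ i → comp (r i)
      ; target = λ i → comp (x i)
      }

    Q : Matrix k m
    Q a j = 𝟙 (comp (punchIn g j) ≟ suc a)

    B : Matrix k q
    B = Q ⊗ D

    χ : (S : Subset q) → ∣ S ∣ ≡ k → ℤ
    χ = maximalMinor B

{-# OPTIONS --safe #-}
-- Since e_g = 0 and g lies in C₀, B_F is the incidence matrix of H_F with the row
-- of the ground vertex C₀ removed, and a choice of rows amounts to identifying
-- the remaining vertices with the ground.  So let k edges on k + 1 vertices be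
-- given.  If an edge joins vertex 1 to another vertex w, adding row 0 to the row
-- of w and expanding along the column of that edge gives, up to sign, the
-- determinant of the contracted graph; if there is no such edge, row 0 vanishes
-- and the graph is disconnected.  By induction the determinant is ±1 if the graph
-- is connected and 0 otherwise.  A connected graph with k edges has no cycle, for
-- an edge of a cycle could be replaced by a loop, whose column is zero.
module Submission where

open import Defs
open import Data.Nat.Base using (ℕ; zero; suc)
open import Data.Integer.Base using (ℤ; 0ℤ; 1ℤ; -1ℤ; _+_; _-_; _*_; _^_; -_)
import Data.Integer.Properties as ℤ
open import Data.Integer.Tactic.RingSolver using (solve-∀)
open import Data.Bool.Base using (if_then_else_)
import Data.Bool.Properties as Bool
open import Data.Fin.Base using (Fin; zero; suc; toℕ; cast; punchIn; punchOut)
open import Data.Fin.Properties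
  using (_≟_; suc-injective; punchIn-punchOut; punchInᵢ≢i; punchIn-injective;
         cast-involutive; any?)
open import Data.Fin.Subset using (Subset; inside; outside; _∈_; ∣_∣)
open import Data.List.Relation.Unary.All using (All; []; _∷_)
open import Data.List.Relation.Unary.AllPairs using (_∷_)
open import Data.Product.Base using (_×_; _,_; ∃-syntax)
open import Data.Sum.Base using (_⊎_; inj₁; inj₂)
open import Data.Vec.Base using (here; there; _∷_)
open import Data.Vec.Functional as Vector using (Vector; updateAt)
open import Data.Vec.Functional.Properties
  using (updateAt-updates; updateAt-minimal)
open import Level using (0ℓ)
open import Function.Base using (_∘_; const; case_of_)
open import Function.Bundles using (_⇔_; mk⇔; Equivalence)
open import Function.Definitions using (Injective)
open import Relation.Binary.Construct.Closure.Equivalence as EqClosure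
  using (EqClosure)
open import Relation.Binary.Construct.Closure.ReflexiveTransitive as Star
  using (Star; ε; _◅_; _◅◅_)
open import Relation.Binary.Core using (Rel)
open import Relation.Binary.Structures using (IsEquivalence)
open import Relation.Binary.PropositionalEquality
  using (_≡_; _≢_; _≗_; refl; sym; trans; cong; cong₂; subst; subst₂; isEquivalence;
         module ≡-Reasoning)
open import Relation.Nullary using (Dec; yes; no; does; ¬_; contradiction)
open import Relation.Nullary.Decidable
  using (dec-true; dec-false; does-⇔; ¬?; decidable-stable)
open import Algebra.Properties.Semiring.Sum ℤ.+-*-semiring
  using (sum-cong-≗; sum-replicate-zero; sum-remove; ∑-distrib-+;
         *-distribˡ-sum)

-- Finite sums with at most one nonzero term

∑-zero : ∀ {n} (f : Vector ℤ n) → (∀ j → f j ≡ 0ℤ) → ∑ f ≡ 0ℤ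
∑-zero {n} f f≡0 = trans (sum-cong-≗ f≡0) (sum-replicate-zero n)

∑-single : ∀ {n} (f : Vector ℤ n) j → (∀ l → l ≢ j → f l ≡ 0ℤ) → ∑ f ≡ f j
∑-single {suc n} f j f≡0 = begin
  ∑ f                        ≡⟨ sum-remove f ⟩
  f j + ∑ (f ∘ punchIn j)    ≡⟨ cong (f j +_) (∑-zero _ λ l → f≡0 _ (punchInᵢ≢i j l)) ⟩
  f j + 0ℤ                   ≡⟨ ℤ.+-identityʳ (f j) ⟩
  f j                        ∎
  where open ≡-Reasoning

-- Determinants

deleteFirstRow : ∀ {n} → Matrix (suc n) (suc n) → Fin (suc n) → Matrix n n
deleteFirstRow A j i k = A (suc i) (punchIn j k)

det-cong : ∀ {n} (A A′ : Matrix n n) → (∀ i j → A i j ≡ A′ i j) → det A ≡ det A′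
det-cong {zero}  A A′ A≗A′ = refl
det-cong {suc n} A A′ A≗A′ = sum-cong-≗ λ j →
  cong₂ (λ a d → -1ℤ ^ toℕ j * a * d) (A≗A′ zero j)
    (det-cong _ _ λ i k → A≗A′ (suc i) (punchIn j k))

*-zero-middle : ∀ s {a} d → a ≡ 0ℤ → s * a * d ≡ 0ℤ
*-zero-middle s d refl = cong (_* d) (ℤ.*-zeroʳ s)

*-zero-last : ∀ s {d} → d ≡ 0ℤ → s * d ≡ 0ℤ
*-zero-last s refl = ℤ.*-zeroʳ s

det-zeroColumn : ∀ {n} (A : Matrix n n) j → (∀ i → A i j ≡ 0ℤ) → det A ≡ 0ℤ
det-zeroColumn {suc n} A j A≡0 = ∑-zero _ term
  where
  term : ∀ l → -1ℤ ^ toℕ l * A zero l * det (deleteFirstRow A l) ≡ 0ℤ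
  term l with l ≟ j
  ... | yes refl = *-zero-middle (-1ℤ ^ toℕ l) _ (A≡0 zero)
  ... | no  l≢j  = *-zero-last (-1ℤ ^ toℕ l * A zero l)
    (det-zeroColumn (deleteFirstRow A l) (punchOut l≢j) λ i →
      trans (cong (A (suc i)) (punchIn-punchOut l≢j)) (A≡0 (suc i)))

-- For `l ≢ j` the minor without column `l` still contains column `j` below its top entry, hence a
-- zero column; so only the term at `j` survives.
det-expandColumn : ∀ {n} (A : Matrix (suc n) (suc n)) j →
  (∀ i → A (suc i) j ≡ 0ℤ) →
  det A ≡ -1ℤ ^ toℕ j * A zero j * det (deleteFirstRow A j)
det-expandColumn A j A≡0 = ∑-single _ j λ l l≢j →
  *-zero-last (-1ℤ ^ toℕ l * A zero l)
    (det-zeroColumn (deleteFirstRow A l) (punchOut l≢j) λ i →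
      trans (cong (A (suc i)) (punchIn-punchOut l≢j)) (A≡0 i))

-- Induction on `p`: in row 0 the coefficients of the expansion split while the minors agree; in a
-- later row the coefficients agree and the minors split.
det-rowAdditive : ∀ {n} p (A X Y : Matrix n n) →
  (∀ j → A p j ≡ X p j + Y p j) →
  (∀ i → i ≢ p → ∀ j → X i j ≡ A i j) →
  (∀ i → i ≢ p → ∀ j → Y i j ≡ A i j) →
  det A ≡ det X + det Y
det-rowAdditive {suc n} p A X Y A≡X+Y X≡A Y≡A =
  trans (sum-cong-≗ (term p A≡X+Y X≡A Y≡A)) (∑-distrib-+ (summand X) (summand Y))
  where
  open ≡-Reasoning

  summand : Matrix (suc n) (suc n) → Vector ℤ (suc n)
  summand C j = -1ℤ ^ toℕ j * C zero j * det (deleteFirstRow C j)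

  distrib-middle : ∀ s x y d → s * (x + y) * d ≡ s * x * d + s * y * d
  distrib-middle = solve-∀

  term : ∀ p →
    (∀ j → A p j ≡ X p j + Y p j) →
    (∀ i → i ≢ p → ∀ j → X i j ≡ A i j) →
    (∀ i → i ≢ p → ∀ j → Y i j ≡ A i j) →
    ∀ j → summand A j ≡ summand X j + summand Y j
  term zero A≡X+Y X≡A Y≡A j = begin
    s * A zero j * d              ≡⟨ cong (λ a → s * a * d) (A≡X+Y j) ⟩
    s * (X zero j + Y zero j) * d ≡⟨ distrib-middle s (X zero j) (Y zero j) d ⟩
    s * X zero j * d + s * Y zero j * d
      ≡⟨ cong₂ (λ c d → s * X zero j * c + s * Y zero j * d)
           (det-cong _ _ λ i k → sym (X≡A (suc i) (λ ()) (punchIn j k)))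
           (det-cong _ _ λ i k → sym (Y≡A (suc i) (λ ()) (punchIn j k))) ⟩
    summand X j + summand Y j     ∎
    where
    s = -1ℤ ^ toℕ j
    d = det (deleteFirstRow A j)
  term (suc p) A≡X+Y X≡A Y≡A j = begin
    a * det (deleteFirstRow A j)
      ≡⟨ cong (a *_) (det-rowAdditive p _ (deleteFirstRow X j) (deleteFirstRow Y j)
           (λ k → A≡X+Y (punchIn j k))
           (λ i i≢p k → X≡A (suc i) (i≢p ∘ suc-injective) (punchIn j k))
           (λ i i≢p k → Y≡A (suc i) (i≢p ∘ suc-injective) (punchIn j k))) ⟩
    a * (det (deleteFirstRow X j) + det (deleteFirstRow Y j))
      ≡⟨ ℤ.*-distribˡ-+ a _ _ ⟩
    a * det (deleteFirstRow X j) + a * det (deleteFirstRow Y j)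
      ≡⟨ cong₂ (λ x y → -1ℤ ^ toℕ j * x * det (deleteFirstRow X j)
                      + -1ℤ ^ toℕ j * y * det (deleteFirstRow Y j))
           (sym (X≡A zero (λ ()) j)) (sym (Y≡A zero (λ ()) j)) ⟩
    summand X j + summand Y j ∎
    where a = -1ℤ ^ toℕ j * A zero j

-- In the double Laplace expansion along two equal rows, the choices of the
-- columns (0 , l) and (l + 1 , 0) cancel; what remains is the expansion with
-- column 0 removed.  The function Φ stands for the minor of the other rows.
∑∑-cancel : ∀ {n} (u : Vector ℤ (suc (suc n))) (Φ : (Fin n → Fin (suc (suc n))) → ℤ) →
  (∀ f h → f ≗ h → Φ f ≡ Φ h) →
  ∑ (λ j → -1ℤ ^ toℕ j * u j *
    ∑ (λ l → -1ℤ ^ toℕ l * u (punchIn j l) * Φ (punchIn j ∘ punchIn l))) ≡ 0ℤ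
∑∑-cancel {zero} u Φ Φ-ext = begin
  -- With two columns there are just two products, of opposite sign; both arguments of `Φ` are
  -- functions on the empty type `Fin 0`, hence pointwise equal.
  _ ≡⟨ cong (λ φ → 1ℤ * u zero * (1ℤ * u (suc zero) * Φ f₀ + 0ℤ)
              + (-1ℤ * 1ℤ * u (suc zero) * (1ℤ * u zero * φ + 0ℤ) + 0ℤ))
         (Φ-ext _ _ λ ()) ⟩
  _ ≡⟨ cancel (u zero) (u (suc zero)) (Φ f₀) ⟩
  0ℤ ∎
  where
  open ≡-Reasoning
  f₀ : Fin 0 → Fin 2
  f₀ i = suc (punchIn zero i)

  cancel : ∀ a b c → 1ℤ * a * (1ℤ * b * c + 0ℤ) + (-1ℤ * 1ℤ * b * (1ℤ * a * c + 0ℤ) + 0ℤ) ≡ 0ℤ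
  cancel = solve-∀
∑∑-cancel {suc n} u Φ Φ-ext = begin
  -- The term with outer column 0 is split off, and from each other term the summand with inner
  -- column 0; these two families cancel in the end.
  1ℤ * u₀ * ∑ X + ∑ (λ j → -1ℤ * s j * u′ j * (1ℤ * u₀ * Φ (suc ∘ punchIn j) + ∑ (Y j)))
    ≡⟨ cong (1ℤ * u₀ * ∑ X +_) (sum-cong-≗ split) ⟩
  1ℤ * u₀ * ∑ X + ∑ (λ j → - u₀ * X j + Z j)
    ≡⟨ cong (1ℤ * u₀ * ∑ X +_) (∑-distrib-+ (λ j → - u₀ * X j) Z) ⟩
  1ℤ * u₀ * ∑ X + (∑ (λ j → - u₀ * X j) + ∑ Z)
    ≡⟨ cong₂ (λ x z → 1ℤ * u₀ * ∑ X + (x + z))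
         (sym (*-distribˡ-sum (- u₀) X)) (∑∑-cancel u′ Φ′ Φ′-ext) ⟩
  1ℤ * u₀ * ∑ X + (- u₀ * ∑ X + 0ℤ)
    ≡⟨ cancel u₀ (∑ X) ⟩
  0ℤ ∎
  where
  open ≡-Reasoning
  cancel : ∀ a x → 1ℤ * a * x + (- a * x + 0ℤ) ≡ 0ℤ
  cancel = solve-∀

  u₀ = u zero
  u′ = u ∘ suc

  s : ∀ {m} → Fin m → ℤ
  s j = -1ℤ ^ toℕ j

  -- In the remaining terms column 0 is chosen by neither expansion, so it stays the first column of
  -- the minor; `Φ′` is that minor as a function of the other columns.
  lift : (Fin n → Fin (suc (suc n))) → Fin (suc n) → Fin (suc (suc (suc n)))
  lift f zero    = zero
  lift f (suc i) = suc (f i)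

  Φ′ : (Fin n → Fin (suc (suc n))) → ℤ
  Φ′ f = Φ (lift f)

  Φ′-ext : ∀ f h → f ≗ h → Φ′ f ≡ Φ′ h
  Φ′-ext f h f≗h = Φ-ext _ _ λ where
    zero    → refl
    (suc i) → cong suc (f≗h i)

  X : Vector ℤ (suc (suc n))
  X l = s l * u′ l * Φ (suc ∘ punchIn l)

  Y Y′ : Fin (suc (suc n)) → Vector ℤ (suc n)
  Y  j l = -1ℤ * s l * u′ (punchIn j l) * Φ (punchIn (suc j) ∘ punchIn (suc l))
  Y′ j l = s l * u′ (punchIn j l) * Φ′ (punchIn j ∘ punchIn l)

  Z : Vector ℤ (suc (suc n))
  Z j = s j * u′ j * ∑ (Y′ j)

  neg : ∀ a b c → -1ℤ * a * b * c ≡ -1ℤ * (a * b * c)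
  neg = solve-∀

  -- The inner index is shifted by one, which costs a sign. The shift of the outer index costs
  -- another one in `split`, so `Z` enters with a plus sign.
  Y≡-Y′ : ∀ j → ∑ (Y j) ≡ -1ℤ * ∑ (Y′ j)
  Y≡-Y′ j = begin
    ∑ (Y j)                    ≡⟨ sum-cong-≗ term ⟩
    ∑ (λ l → -1ℤ * Y′ j l)     ≡⟨ *-distribˡ-sum -1ℤ (Y′ j) ⟨
    -1ℤ * ∑ (Y′ j)             ∎
    where
    term : ∀ l → Y j l ≡ -1ℤ * Y′ j l
    term l = begin
      Y j l ≡⟨ cong (-1ℤ * s l * u′ (punchIn j l) *_) (Φ-ext _ _ λ where
                 zero    → refl
                 (suc i) → refl) ⟩
      -1ℤ * s l * u′ (punchIn j l) * Φ′ (punchIn j ∘ punchIn l)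
            ≡⟨ neg (s l) (u′ (punchIn j l)) _ ⟩
      -1ℤ * Y′ j l ∎

  rearrange : ∀ s a b φ y →
    -1ℤ * s * b * (1ℤ * a * φ + -1ℤ * y) ≡ - a * (s * b * φ) + s * b * y
  rearrange = solve-∀

  split : ∀ j → -1ℤ * s j * u′ j * (1ℤ * u₀ * Φ (suc ∘ punchIn j) + ∑ (Y j))
              ≡ - u₀ * X j + Z j
  split j = begin
    _ ≡⟨ cong (λ y → -1ℤ * s j * u′ j * (1ℤ * u₀ * Φ (suc ∘ punchIn j) + y)) (Y≡-Y′ j) ⟩
    _ ≡⟨ rearrange (s j) u₀ (u′ j) (Φ (suc ∘ punchIn j)) (∑ (Y′ j)) ⟩
    _ ∎

det-equalFirstRows : ∀ {n} (A : Matrix (suc (suc n)) (suc (suc n))) →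
  (∀ j → A (suc zero) j ≡ A zero j) → det A ≡ 0ℤ
det-equalFirstRows A A₁≡A₀ = begin
  det A ≡⟨ det-cong A A′ (λ where
             zero          j → refl
             (suc zero)    j → A₁≡A₀ j
             (suc (suc i)) j → refl) ⟩
  det A′ ≡⟨ ∑∑-cancel (A zero) (λ f → det λ i k → A (suc (suc i)) (f k))
             (λ f h f≗h → det-cong _ _ λ i k → cong (A (suc (suc i))) (f≗h k)) ⟩
  0ℤ    ∎
  where
  open ≡-Reasoning
  -- With row 0 repeated literally, `det A′` unfolds to the double sum of `∑∑-cancel`.
  A′ : Matrix _ _
  A′ = A zero Vector.∷ A zero Vector.∷ λ i → A (suc (suc i))

-- Rows 0 and i + 2 are compared through row 1, by expanding the vanishing
-- determinant with both rows 0 and 1 replaced by their sum.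
det-equalRows : ∀ {n} (A : Matrix (suc n) (suc n)) i →
  (∀ j → A (suc i) j ≡ A zero j) → det A ≡ 0ℤ
det-equalRows {suc n} A zero    Aᵢ≡A₀ = det-equalFirstRows A Aᵢ≡A₀
det-equalRows {suc n} A (suc i) Aᵢ≡A₀ = begin
  det A                              ≡⟨ det-cong A (M x y) (λ where
                                          zero          j → refl
                                          (suc zero)    j → refl
                                          (suc (suc i)) j → refl) ⟩
  det (M x y)                        ≡⟨ pad (det (M x y)) ⟩
  (0ℤ + det (M x y)) + (0ℤ + 0ℤ)     ≡⟨ cong₂ _+_
                                          (cong (_+ det (M x y)) (sym (twice x)))
                                          (cong₂ _+_ (sym yx) (sym (twice y))) ⟩
  (det (M x x) + det (M x y)) + (det (M y x) + det (M y y))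
                                     ≡⟨ cong₂ _+_ (sym (second x)) (sym (second y)) ⟩
  det (M x z) + det (M y z)          ≡⟨ first ⟨
  det (M z z)                        ≡⟨ twice z ⟩
  0ℤ                                 ∎
  where
  open ≡-Reasoning

  pad : ∀ a → a ≡ (0ℤ + a) + (0ℤ + 0ℤ)
  pad = solve-∀

  M : Vector ℤ (suc (suc n)) → Vector ℤ (suc (suc n)) → Matrix (suc (suc n)) (suc (suc n))
  M v w = v Vector.∷ w Vector.∷ λ i → A (suc (suc i))

  x y z : Vector ℤ (suc (suc n))
  x   = A zero
  y   = A (suc zero)
  z j = x j + y j

  twice : ∀ v → det (M v v) ≡ 0ℤ
  twice v = det-equalFirstRows (M v v) λ j → refl

  -- With `y` on top, both equal rows lie below the first row, so the induction hypothesis at `i`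
  -- makes every minor vanish.
  yx : det (M y x) ≡ 0ℤ
  yx = ∑-zero _ λ j → *-zero-last (-1ℤ ^ toℕ j * y j)
    (det-equalRows (deleteFirstRow (M y x) j) i λ k → Aᵢ≡A₀ (punchIn j k))

  first : det (M z z) ≡ det (M x z) + det (M y z)
  first = det-rowAdditive zero (M z z) (M x z) (M y z) (λ j → refl) same same
    where
    same : ∀ {v} i → i ≢ zero → ∀ j → M v z i j ≡ M z z i j
    same zero          0≢0 j = contradiction refl 0≢0
    same (suc zero)    _   j = refl
    same (suc (suc i)) _   j = refl

  second : ∀ v → det (M v z) ≡ det (M v x) + det (M v y)
  second v = det-rowAdditive (suc zero) (M v z) (M v x) (M v y) (λ j → refl) same same
    where
    same : ∀ {w} i → i ≢ suc zero → ∀ j → M v w i j ≡ M v z i j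
    same zero          _   j = refl
    same (suc zero)    1≢1 j = contradiction refl 1≢1
    same (suc (suc i)) _   j = refl

-- Additivity in row `suc i` splits off the determinant of a matrix in which this row repeats row 0.
det-addFirstRow : ∀ {n} (A A′ : Matrix (suc n) (suc n)) i →
  (∀ j → A′ (suc i) j ≡ A (suc i) j + A zero j) →
  (∀ l → l ≢ suc i → ∀ j → A′ l j ≡ A l j) →
  det A′ ≡ det A
det-addFirstRow A A′ i A′ᵢ A′ₗ = begin
  det A′        ≡⟨ det-rowAdditive (suc i) A′ A E
                     (λ j → trans (A′ᵢ j)
                       (cong (λ v → A (suc i) j + v j) (sym (updateAt-updates (suc i) A))))
                     (λ l l≢i j → sym (A′ₗ l l≢i j))
                     (λ l l≢i j → trans
                       (cong (λ v → v j) (updateAt-minimal l (suc i) A l≢i))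
                       (sym (A′ₗ l l≢i j))) ⟩
  det A + det E ≡⟨ cong (det A +_) (det-equalRows E i λ j →
                     cong (λ v → v j) (updateAt-updates (suc i) A)) ⟩
  det A + 0ℤ    ≡⟨ ℤ.+-identityʳ (det A) ⟩
  det A         ∎
  where
  open ≡-Reasoning
  E : Matrix _ _
  E = updateAt A (suc i) (const (A zero))

-- Reduced incidence matrices

𝟙-true : ∀ {P : Set} (P? : Dec P) → P → 𝟙 P? ≡ 1ℤ
𝟙-true P? p = cong (if_then 1ℤ else 0ℤ) (dec-true P? p)

𝟙-false : ∀ {P : Set} (P? : Dec P) → ¬ P → 𝟙 P? ≡ 0ℤ
𝟙-false P? ¬p = cong (if_then 1ℤ else 0ℤ) (dec-false P? ¬p)

𝟙-cong : ∀ {P P′ : Set} → P ⇔ P′ → (P? : Dec P) (P′? : Dec P′) → 𝟙 P? ≡ 𝟙 P′?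
𝟙-cong P⇔P′ P? P′? = cong (if_then 1ℤ else 0ℤ) (does-⇔ P⇔P′ P? P′?)

IsUnit : ℤ → Set
IsUnit z = z ≡ 1ℤ ⊎ z ≡ -1ℤ

isUnit-* : ∀ {y z} → IsUnit y → IsUnit z → IsUnit (y * z)
isUnit-* (inj₁ refl) (inj₁ refl) = inj₁ refl
isUnit-* (inj₁ refl) (inj₂ refl) = inj₂ refl
isUnit-* (inj₂ refl) (inj₁ refl) = inj₂ refl
isUnit-* (inj₂ refl) (inj₂ refl) = inj₁ refl

isUnit-^ : ∀ {z} → IsUnit z → ∀ n → IsUnit (z ^ n)
isUnit-^ u zero    = inj₁ refl
isUnit-^ u (suc n) = isUnit-* u (isUnit-^ u n)

isUnit⇒≢0 : ∀ {z} → IsUnit z → z ≢ 0ℤ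
isUnit⇒≢0 (inj₁ refl) ()
isUnit⇒≢0 (inj₂ refl) ()

incidence : ∀ {k e} (s t : Fin e → Fin (suc k)) → Matrix k e
incidence s t a i = 𝟙 (t i ≟ suc a) - 𝟙 (s i ≟ suc a)

data Edge {n e} (s t : Fin e → Fin n) : Rel (Fin n) 0ℓ where
  edge : ∀ i → Edge s t (s i) (t i)

Linked : ∀ {n e} (s t : Fin e → Fin n) → Rel (Fin n) 0ℓ
Linked s t = EqClosure (Edge s t)

Spanning : ∀ {n e} (s t : Fin e → Fin n) → Set
Spanning s t = ∀ u v → Linked s t u v

linked-sym : ∀ {n e} {s t : Fin e → Fin n} {u v} → Linked s t u v → Linked s t v u
linked-sym = EqClosure.symmetric _

link : ∀ {n e} {s t : Fin e → Fin n} i → Linked s t (s i) (t i)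
link i = EqClosure.return (edge i)

-- Identifies vertex 1 with vertex w of the result.
merge : ∀ {n} → Fin (suc n) → Fin (suc (suc n)) → Fin (suc n)
merge w zero          = zero
merge w (suc zero)    = w
merge w (suc (suc a)) = suc a

merge-punchIn : ∀ {n} (w : Fin (suc n)) a → merge w (punchIn (suc zero) a) ≡ a
merge-punchIn w zero    = refl
merge-punchIn w (suc a) = refl

-- The ground vertex has no row, so merging vertex 1 into it leaves the other rows unchanged.
𝟙-merge-zero : ∀ {n} (a : Fin n) v → 𝟙 (merge zero v ≟ suc a) ≡ 𝟙 (v ≟ suc (suc a))
𝟙-merge-zero a zero          = refl
𝟙-merge-zero a (suc zero)    = refl
𝟙-merge-zero a (suc (suc b)) = refl

-- The vertex that absorbs vertex 1 collects the indicators of both: this is the row addition, entry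
-- by entry.
𝟙-merge-suc : ∀ {n} (a : Fin n) v →
  𝟙 (merge (suc a) v ≟ suc a) ≡ 𝟙 (v ≟ suc (suc a)) + 𝟙 (v ≟ suc zero)
𝟙-merge-suc a zero          = refl
𝟙-merge-suc a (suc zero)    = 𝟙-true (suc a ≟ suc a) refl
𝟙-merge-suc a (suc (suc b)) = sym (ℤ.+-identityʳ _)

𝟙-merge-≢ : ∀ {n} {a b : Fin n} → a ≢ b →
  ∀ v → 𝟙 (merge (suc b) v ≟ suc a) ≡ 𝟙 (v ≟ suc (suc a))
𝟙-merge-≢                 a≢b zero          = refl
𝟙-merge-≢ {a = a} {b = b} a≢b (suc zero)    =
  𝟙-false (suc b ≟ suc a) (a≢b ∘ sym ∘ suc-injective)
𝟙-merge-≢                 a≢b (suc (suc c)) = refl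

-- Contracting edge j, which joins vertex 1 to w, amounts to adding row 0 of the
-- incidence matrix to the row of w (if w is not the ground vertex); after that,
-- only row 0 is nonzero in column j.
det-contract : ∀ {n} (s t : Fin (suc n) → Fin (suc (suc n))) w j →
  merge w (s j) ≡ merge w (t j) →
  det (incidence s t) ≡
    -1ℤ ^ toℕ j * incidence s t zero j *
    det (incidence (merge w ∘ s ∘ punchIn j) (merge w ∘ t ∘ punchIn j))
det-contract {n} s t w j merged =
  trans (sym (det-rows w)) (det-expandColumn (rows w) j column)
  where
  rows : Fin (suc n) → Matrix (suc n) (suc n)
  rows w = incidence s t zero Vector.∷ incidence (merge w ∘ s) (merge w ∘ t)

  column : ∀ a → rows w (suc a) j ≡ 0ℤ
  column a = trans
    (cong (λ v → 𝟙 (merge w (t j) ≟ suc a) - 𝟙 (v ≟ suc a)) merged)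
    (ℤ.+-inverseʳ (𝟙 (merge w (t j) ≟ suc a)))

  interchange : ∀ a b c d → (a + b) - (c + d) ≡ (a - c) + (b - d)
  interchange = solve-∀

  det-rows : ∀ w → det (rows w) ≡ det (incidence s t)
  det-rows zero    = det-cong (rows zero) (incidence s t) λ where
    zero    i → refl
    (suc a) i → cong₂ _-_ (𝟙-merge-zero a (t i)) (𝟙-merge-zero a (s i))
  det-rows (suc b) = det-addFirstRow (incidence s t) (rows (suc b)) b
    (λ i → trans (cong₂ _-_ (𝟙-merge-suc b (t i)) (𝟙-merge-suc b (s i)))
                 (interchange (𝟙 (t i ≟ suc (suc b))) (𝟙 (t i ≟ suc zero))
                              (𝟙 (s i ≟ suc (suc b))) (𝟙 (s i ≟ suc zero))))
    λ where
      zero    _   i → refl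
      (suc a) a≢b i → cong₂ _-_
        (𝟙-merge-≢ (a≢b ∘ cong suc) (t i)) (𝟙-merge-≢ (a≢b ∘ cong suc) (s i))

-- Determinant and connectedness under contraction

data Dichotomy {n} (s t : Fin n → Fin (suc n)) : Set where
  spanning    : Spanning s t → IsUnit (det (incidence s t)) → Dichotomy s t
  nonspanning : ¬ Spanning s t → det (incidence s t) ≡ 0ℤ → Dichotomy s t

-- `w` is numbered as in the contracted graph, where vertex 1 is gone; `punchIn (suc zero) w` is the
-- same vertex before contraction. The cases of `ends` are the two directions of edge `j`.
module Contraction {n} (s t : Fin (suc n) → Fin (suc (suc n)))
  (w : Fin (suc n)) (j : Fin (suc n))
  (ends : (s j ≡ suc zero × t j ≡ punchIn (suc zero) w) ⊎
          (s j ≡ punchIn (suc zero) w × t j ≡ suc zero))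
  where

  s′ t′ : Fin n → Fin (suc n)
  s′ = merge w ∘ s ∘ punchIn j
  t′ = merge w ∘ t ∘ punchIn j

  merged : merge w (s j) ≡ merge w (t j)
  merged = case ends of λ where
    (inj₁ (s≡1 , t≡w)) → trans (cong (merge w) s≡1)
      (sym (trans (cong (merge w) t≡w) (merge-punchIn w w)))
    (inj₂ (s≡w , t≡1)) → trans (cong (merge w) s≡w)
      (trans (merge-punchIn w w) (sym (cong (merge w) t≡1)))

  linked-ends : Linked s t (punchIn (suc zero) w) (suc zero)
  linked-ends = case ends of λ where
    (inj₁ (s≡1 , t≡w)) → linked-sym (subst₂ (Linked s t) s≡1 t≡w (link j))
    (inj₂ (s≡w , t≡1)) → subst₂ (Linked s t) s≡w t≡1 (link j)

  isUnit-incidence : IsUnit (incidence s t zero j)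
  isUnit-incidence = case ends of λ where
    (inj₁ (s≡1 , t≡w)) → inj₂ (cong₂ _-_
      (𝟙-false (t j ≟ suc zero) λ t≡1 → punchInᵢ≢i (suc zero) w (trans (sym t≡w) t≡1))
      (𝟙-true (s j ≟ suc zero) s≡1))
    (inj₂ (s≡w , t≡1)) → inj₁ (cong₂ _-_
      (𝟙-true (t j ≟ suc zero) t≡1)
      (𝟙-false (s j ≟ suc zero) λ s≡1 → punchInᵢ≢i (suc zero) w (trans (sym s≡w) s≡1)))

  -- `punchIn (suc zero)` chooses a representative of each class of `merge w`. It differs from `v`
  -- only for vertex 1, where edge `j` provides the link.
  linked-representative : ∀ v → Linked s t (punchIn (suc zero) (merge w v)) v
  linked-representative zero          = ε
  linked-representative (suc zero)    = linked-ends
  linked-representative (suc (suc a)) = ε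

  contracted⇒spanning : Spanning s′ t′ → Spanning s t
  contracted⇒spanning spans u v =
    linked-sym (linked-representative u)
    ◅◅ EqClosure.gfold (EqClosure.isEquivalence _) (punchIn (suc zero))
         (λ { (edge i) → linked-representative (s (punchIn j i))
                         ◅◅ link (punchIn j i)
                         ◅◅ linked-sym (linked-representative (t (punchIn j i))) })
         (spans (merge w u) (merge w v))
    ◅◅ linked-representative v

  linked-contracted : ∀ i → Linked s′ t′ (merge w (s i)) (merge w (t i))
  linked-contracted i with j ≟ i
  -- The contracted edge has become a loop, so its ends coincide.
  ... | yes refl = subst (Linked s′ t′ _) merged ε
  ... | no  j≢i  = subst (λ l → Linked s′ t′ (merge w (s l)) (merge w (t l)))
                     (punchIn-punchOut j≢i) (link (punchOut j≢i))

  spanning⇒contracted : Spanning s t → Spanning s′ t′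
  spanning⇒contracted spans a b =
    subst₂ (Linked s′ t′) (merge-punchIn w a) (merge-punchIn w b)
      (EqClosure.gfold (EqClosure.isEquivalence _) (merge w)
        (λ { (edge i) → linked-contracted i })
        (spans (punchIn (suc zero) a) (punchIn (suc zero) b)))

  dichotomy-contract : Dichotomy s′ t′ → Dichotomy s t
  dichotomy-contract (spanning spans unit) =
    spanning (contracted⇒spanning spans)
      (subst IsUnit (sym (det-contract s t w j merged))
        (isUnit-* (isUnit-* (isUnit-^ (inj₂ refl) (toℕ j)) isUnit-incidence) unit))
  dichotomy-contract (nonspanning ¬spans det≡0) =
    nonspanning (¬spans ∘ spanning⇒contracted)
      (trans (det-contract s t w j merged)
        (*-zero-last (-1ℤ ^ toℕ j * incidence s t zero j) det≡0))

-- No edge leaves vertex 1, so being vertex 1 is invariant along links and separates it from vertex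
-- 0. In row 0 each edge contributes equal indicators, which cancel.
dichotomy-isolated : ∀ {n} (s t : Fin (suc n) → Fin (suc (suc n))) →
  (∀ i → does (s i ≟ suc zero) ≡ does (t i ≟ suc zero)) → Dichotomy s t
dichotomy-isolated s t isolated = nonspanning
  (λ spans → case invariant (spans zero (suc zero)) of λ ())
  (∑-zero _ λ i → *-zero-middle (-1ℤ ^ toℕ i) (det (deleteFirstRow (incidence s t) i)) (trans
    (cong (λ b → 𝟙 (t i ≟ suc zero) - (if b then 1ℤ else 0ℤ)) (isolated i))
    (ℤ.+-inverseʳ (𝟙 (t i ≟ suc zero)))))
  where
  invariant : ∀ {u v} → Linked s t u v → does (u ≟ suc zero) ≡ does (v ≟ suc zero)
  invariant = EqClosure.gfold isEquivalence (λ v → does (v ≟ suc zero))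
    λ { (edge i) → isolated i }

dichotomy : ∀ {n} (s t : Fin n → Fin (suc n)) → Dichotomy s t
dichotomy {zero}  s t = spanning (λ { zero zero → ε }) (inj₁ refl)
dichotomy {suc n} s t
  -- Comparing the two Booleans finds an edge with exactly one end at vertex 1; a loop there cannot
  -- be chosen for contraction.
  with any? (λ i → ¬? (does (s i ≟ suc zero) Bool.≟ does (t i ≟ suc zero)))
... | no  none    = dichotomy-isolated s t λ i →
  decidable-stable (_ Bool.≟ _) λ differ → none (i , differ)
... | yes (j , differ) with s j ≟ suc zero | t j ≟ suc zero
...   | yes _   | yes _   = contradiction refl differ
...   | no  _   | no  _   = contradiction refl differ
...   | yes s≡1 | no  t≢1 =
  Contraction.dichotomy-contract s t (punchOut (t≢1 ∘ sym)) j
    (inj₁ (s≡1 , sym (punchIn-punchOut (t≢1 ∘ sym)))) (dichotomy _ _)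
...   | no  s≢1 | yes t≡1 =
  Contraction.dichotomy-contract s t (punchOut (s≢1 ∘ sym)) j
    (inj₂ (sym (punchIn-punchOut (s≢1 ∘ sym)) , t≡1)) (dichotomy _ _)

dichotomy⇒∈0±1 : ∀ {n} {s t : Fin n → Fin (suc n)} →
  Dichotomy s t → det (incidence s t) ∈0±1
dichotomy⇒∈0±1 (spanning    _ (inj₁ ≡1))  = is+1 ≡1
dichotomy⇒∈0±1 (spanning    _ (inj₂ ≡-1)) = is-1 ≡-1
dichotomy⇒∈0±1 (nonspanning _ ≡0)         = is0 ≡0

-- Selecting rows and columns

-- `f` lists the rows to keep. The vertices of all other rows are sent to the ground, so that the
-- selected rows form the incidence matrix of the collapsed graph.
collapse : ∀ {k n} → (Fin n → Fin k) → Fin (suc k) → Fin (suc n)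
collapse f v with any? (λ i → v ≟ suc (f i))
... | yes (i , _) = suc i
... | no  _       = zero

-- Injectivity ensures that the index found by the search is `i` itself.
collapse-⇔ : ∀ {k n} (f : Fin n → Fin k) → Injective _≡_ _≡_ f →
  ∀ v i → v ≡ suc (f i) ⇔ collapse f v ≡ suc i
collapse-⇔ f f-injective v i with any? (λ l → v ≟ suc (f l))
... | yes (l , v≡fl) = mk⇔
  (λ v≡fi → cong suc (f-injective (suc-injective (trans (sym v≡fl) v≡fi))))
  (λ { refl → v≡fl })
... | no  none       = mk⇔ (λ v≡fi → contradiction (i , v≡fi) none) λ ()

elements-injective : ∀ {n} (S : Subset n) → Injective _≡_ _≡_ (elements S)
elements-injective (inside  ∷ S) {zero}  {zero}  _  = refl
elements-injective (inside  ∷ S) {suc i} {suc j} eq =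
  cong suc (elements-injective S (suc-injective eq))
elements-injective (outside ∷ S)                 eq =
  elements-injective S (suc-injective eq)

elements-∈ : ∀ {n} (S : Subset n) i → elements S i ∈ S
elements-∈ (inside  ∷ S) zero    = here
elements-∈ (inside  ∷ S) (suc i) = there (elements-∈ S i)
elements-∈ (outside ∷ S) i       = there (elements-∈ S i)

elements-surjective : ∀ {n} (S : Subset n) {x} → x ∈ S → ∃[ i ] elements S i ≡ x
elements-surjective (inside  ∷ S) here        = zero , refl
elements-surjective (inside  ∷ S) (there x∈S) with elements-surjective S x∈S
... | i , refl = suc i , refl
elements-surjective (outside ∷ S) (there x∈S) with elements-surjective S x∈S
... | i , refl = i , refl

minor-incidence-∈0±1 : ∀ {k n e} (s t : Fin e → Fin (suc k))
  (f : Fin n → Fin k) → Injective _≡_ _≡_ f → (c : Fin n → Fin e) →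
  det (λ i j → incidence s t (f i) (c j)) ∈0±1
minor-incidence-∈0±1 s t f f-injective c =
  subst _∈0±1 (sym (det-cong _ (incidence s′ t′) λ i j → cong₂ _-_
      (𝟙-cong (collapse-⇔ f f-injective (t (c j)) i)
        (t (c j) ≟ suc (f i)) (t′ j ≟ suc i))
      (𝟙-cong (collapse-⇔ f f-injective (s (c j)) i)
        (s (c j) ≟ suc (f i)) (s′ j ≟ suc i))))
    (dichotomy⇒∈0±1 (dichotomy s′ t′))
  where
  s′ = collapse f ∘ s ∘ c
  t′ = collapse f ∘ t ∘ c

-- Spanning trees of a multigraph with a chosen edge set

module _ {k q} (H : Multigraph (suc k) q) (S : Subset q) (c : Fin k → Fin q)
  (c-∈ : ∀ i → c i ∈ S) (c-surjective : ∀ {x} → x ∈ S → ∃[ i ] c i ≡ x)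
  where

  open Multigraph H

  joins-sym : ∀ {x u v} → Joins H S x u v → Joins H S x v u
  joins-sym (inj₁ (s≡u , t≡v)) = inj₂ (s≡u , t≡v)
  joins-sym (inj₂ (s≡v , t≡u)) = inj₁ (s≡v , t≡u)

  walk-isEquivalence : IsEquivalence (Star (Step H S))
  walk-isEquivalence = record
    { refl  = ε
    ; sym   = Star.reverse λ (x , x∈S , joins) → x , x∈S , joins-sym joins
    ; trans = _◅◅_
    }

  linked⇒walk : ∀ {u v} → Linked (source ∘ c) (target ∘ c) u v → Star (Step H S) u v
  linked⇒walk = EqClosure.fold walk-isEquivalence
    λ { (edge i) → (c i , c-∈ i , inj₁ (refl , refl)) ◅ ε }

  walk⇒linked : ∀ {u v} → Star (Step H S) u v → Linked (source ∘ c) (target ∘ c) u v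
  walk⇒linked ε = ε
  walk⇒linked ((x , x∈S , joins) ◅ w) with c-surjective x∈S
  walk⇒linked ((x , x∈S , inj₁ (refl , refl)) ◅ w) | i , refl =
    link i ◅◅ walk⇒linked w
  walk⇒linked ((x , x∈S , inj₂ (refl , refl)) ◅ w) | i , refl =
    linked-sym (link i) ◅◅ walk⇒linked w

  -- Replacing an edge x of a cycle by a loop at the ground vertex preserves
  -- connectedness, but makes column x of the incidence matrix zero.
  module Bypass (x : Fin q) (x∈S : x ∈ S) where

    -- The edge becomes a loop instead of being deleted, so there are still `k` edges and
    -- `dichotomy` applies.
    unless-x : Fin q → Fin (suc k) → Fin (suc k)
    unless-x y v = if does (y ≟ x) then zero else v

    unless-x-≢ : ∀ {y} → y ≢ x → ∀ v → unless-x y v ≡ v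
    unless-x-≢ {y} y≢x v = cong (if_then zero else v) (dec-false (y ≟ x) y≢x)

    s′ t′ : Fin k → Fin (suc k)
    s′ i = unless-x (c i) (source (c i))
    t′ i = unless-x (c i) (target (c i))

    link′ : ∀ i → c i ≢ x → Linked s′ t′ (source (c i)) (target (c i))
    link′ i c≢x = subst₂ (Linked s′ t′) (unless-x-≢ c≢x _) (unless-x-≢ c≢x _) (link i)

    walk⇒linked′ : ∀ {u v} (w : Star (Step H S) u v) →
      All (x ≢_) (edges H S w) → Linked s′ t′ u v
    walk⇒linked′ ε [] = ε
    walk⇒linked′ ((y , y∈S , joins) ◅ w) (x≢y ∷ x∉w) with c-surjective y∈S
    walk⇒linked′ ((y , y∈S , inj₁ (refl , refl)) ◅ w) (x≢y ∷ x∉w) | i , refl =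
      link′ i (x≢y ∘ sym) ◅◅ walk⇒linked′ w x∉w
    walk⇒linked′ ((y , y∈S , inj₂ (refl , refl)) ◅ w) (x≢y ∷ x∉w) | i , refl =
      linked-sym (link′ i (x≢y ∘ sym)) ◅◅ walk⇒linked′ w x∉w

    bypass : Spanning (source ∘ c) (target ∘ c) →
      Linked s′ t′ (source x) (target x) → Spanning s′ t′
    bypass spans detour u v =
      EqClosure.fold (EqClosure.isEquivalence _) (λ { (edge i) → link″ i }) (spans u v)
      where
      link″ : ∀ i → Linked s′ t′ (source (c i)) (target (c i))
      link″ i with c i ≟ x
      ... | yes c≡x = subst (λ y → Linked s′ t′ (source y) (target y)) (sym c≡x) detour
      ... | no  c≢x = link′ i c≢x

    det-bypass : det (incidence s′ t′) ≡ 0ℤ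
    det-bypass with c-surjective x∈S
    ... | i , c≡x = det-zeroColumn (incidence s′ t′) i λ a →
      cong₂ (λ u v → 𝟙 (u ≟ suc a) - 𝟙 (v ≟ suc a)) (loop (target (c i))) (loop (source (c i)))
      where
      loop : ∀ v → unless-x (c i) v ≡ zero
      loop v = cong (if_then zero else v) (dec-true (c i ≟ x) c≡x)

    ¬spanning-bypass : ¬ Spanning s′ t′
    ¬spanning-bypass spans with dichotomy s′ t′
    ... | spanning    _ unit   = isUnit⇒≢0 unit det-bypass
    ... | nonspanning ¬spans _ = ¬spans spans

  -- The edges of a cycle are distinct, so the part after its first edge `x` avoids `x` and joins
  -- the ends of `x`. It serves as the detour, and the bypassed graph would be spanning with
  -- determinant zero.
  spanning⇒acyclic : Spanning (source ∘ c) (target ∘ c) →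
    ∀ {v} (w : Star (Step H S) v v) → ¬ IsEdgeCycle H S w
  spanning⇒acyclic spans ((x , x∈S , joins) ◅ w) (_ , (x∉w ∷ _) , _) =
    ¬spanning-bypass (bypass spans (detour joins (walk⇒linked′ w x∉w)))
    where
    open Bypass x x∈S
    detour : ∀ {u v} → Joins H S x u v → Linked s′ t′ v u →
      Linked s′ t′ (source x) (target x)
    detour (inj₁ (refl , refl)) = linked-sym
    detour (inj₂ (refl , refl)) l = l

  spanning⇔isSpanningTree : Spanning (source ∘ c) (target ∘ c) ⇔ IsSpanningTree H S
  spanning⇔isSpanningTree = mk⇔
    (λ spans → record
      { connected = λ u v → linked⇒walk (spans u v)
      ; acyclic   = spanning⇒acyclic spans
      })
    (λ tree u v → walk⇒linked (IsSpanningTree.connected tree u v))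

  det≢0⇔isSpanningTree :
    det (incidence (source ∘ c) (target ∘ c)) ≢ 0ℤ ⇔ IsSpanningTree H S
  det≢0⇔isSpanningTree with dichotomy (source ∘ c) (target ∘ c)
  ... | spanning spans unit = mk⇔
    (λ _ → Equivalence.to spanning⇔isSpanningTree spans)
    (λ _ → isUnit⇒≢0 unit)
  ... | nonspanning ¬spans det≡0 = mk⇔
    (contradiction det≡0)
    (λ tree → contradiction (Equivalence.from spanning⇔isSpanningTree tree) ¬spans)

-- The matrix `B` as a reduced incidence matrix

module _ {m} (P : Superports (suc m)) where
  open Superports P

  module _ {F : Graph (suc m)} {k} (C : ComponentOrder F g k) where
    open ComponentOrder C using (comp) renaming (ground to comp-ground)

    -- For `v` other than `g` the basis vector selects one column of `Q`. For `g` the sum is zero,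
    -- and so is the right side, because `g` lies in component 0.
    Q-e : ∀ a v → ∑ (λ j → Q P C a j * e P v j) ≡ 𝟙 (comp v ≟ suc a)
    Q-e a v with g ≟ v
    ... | yes refl = trans
      (∑-zero _ λ j → *-zero-last (Q P C a j) (𝟙-false (punchIn g j ≟ g) (punchInᵢ≢i g j)))
      (sym (cong (λ u → 𝟙 (u ≟ suc a)) comp-ground))
    ... | no  g≢v  = begin
      ∑ (λ j → Q P C a j * e P v j) ≡⟨ ∑-single _ j₀ (λ l l≢j₀ →
                                         *-zero-last (Q P C a l) (𝟙-false (punchIn g l ≟ v)
                                           λ l≡v → l≢j₀ (punchIn-injective g l j₀
                                             (trans l≡v (sym (punchIn-punchOut g≢v)))))) ⟩
      Q P C a j₀ * e P v j₀         ≡⟨ cong (Q P C a j₀ *_)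
                                         (𝟙-true (punchIn g j₀ ≟ v) (punchIn-punchOut g≢v)) ⟩
      Q P C a j₀ * 1ℤ               ≡⟨ ℤ.*-identityʳ _ ⟩
      Q P C a j₀                    ≡⟨ cong (λ u → 𝟙 (comp u ≟ suc a)) (punchIn-punchOut g≢v) ⟩
      𝟙 (comp v ≟ suc a)            ∎
      where
      open ≡-Reasoning
      j₀ = punchOut g≢v

    B≡incidence : ∀ a i → B P C a i ≡ incidence (comp ∘ r) (comp ∘ x) a i
    B≡incidence a i = begin
      ∑ (λ j → Q P C a j * (e P (x i) j - e P (r i) j))
        ≡⟨ sum-cong-≗ (λ j → distrib (Q P C a j) (e P (x i) j) (e P (r i) j)) ⟩
      ∑ (λ j → Qe (x i) j + -1ℤ * Qe (r i) j)
        ≡⟨ ∑-distrib-+ (Qe (x i)) (λ j → -1ℤ * Qe (r i) j) ⟩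
      ∑ (Qe (x i)) + ∑ (λ j → -1ℤ * Qe (r i) j)
        ≡⟨ cong (∑ (Qe (x i)) +_) (sym (*-distribˡ-sum -1ℤ (Qe (r i)))) ⟩
      ∑ (Qe (x i)) + -1ℤ * ∑ (Qe (r i))
        ≡⟨ cong₂ (λ y z → y + -1ℤ * z) (Q-e a (x i)) (Q-e a (r i)) ⟩
      𝟙 (comp (x i) ≟ suc a) + -1ℤ * 𝟙 (comp (r i) ≟ suc a)
        ≡⟨ cong (𝟙 (comp (x i) ≟ suc a) +_) (ℤ.-1*i≡-i _) ⟩
      incidence (comp ∘ r) (comp ∘ x) a i ∎
      where
      open ≡-Reasoning
      Qe : Fin (suc m) → Vector ℤ m
      Qe v j = Q P C a j * e P v j

      distrib : ∀ a b c → a * (b - c) ≡ a * b + -1ℤ * (a * c)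
      distrib = solve-∀

lemma3p2 : ∀ {m} (G : Graph (suc m)) → Connected G →
    (P : Superports (suc m)) →
    (F : Graph (suc m)) → IsSpanningForest G F →
    ∀ {k} (C : ComponentOrder F (Superports.g P) k) →
    (∀ (T : Subset k) (S : Subset (Superports.q P)) (eq : ∣ T ∣ ≡ ∣ S ∣) →
    minor (B P C) T S eq ∈0±1)
    ×
    (∀ (S : Subset (Superports.q P)) (eq : ∣ S ∣ ≡ k) →
    χ P C S eq ∈0±1 ×
    (χ P C S eq ≢ 0ℤ ⇔ IsSpanningTree (quotientGraph P C) S))
lemma3p2 _ _ P F _ {k} C = minors , maximal
  where
  open Superports P using (x; r; q)
  open ComponentOrder C using (comp)

  minors : ∀ T S (eq : ∣ T ∣ ≡ ∣ S ∣) → minor (B P C) T S eq ∈0±1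
  minors T S eq = subst _∈0±1
    (sym (det-cong _ _ λ i j → B≡incidence P C (elements T i) (elements S (cast eq j))))
    (minor-incidence-∈0±1 (comp ∘ r) (comp ∘ x) (elements T) (elements-injective T)
      (elements S ∘ cast eq))

  maximal : ∀ S (eq : ∣ S ∣ ≡ k) →
    χ P C S eq ∈0±1 × (χ P C S eq ≢ 0ℤ ⇔ IsSpanningTree (quotientGraph P C) S)
  -- Both claims are proved for the incidence matrix of the edges in `S` and carried over to `χ`
  -- together.
  maximal S eq = subst (λ z → z ∈0±1 × (z ≢ 0ℤ ⇔ IsSpanningTree (quotientGraph P C) S))
    (sym (det-cong _ _ λ i j → B≡incidence P C i (c j)))
    ( dichotomy⇒∈0±1 (dichotomy (comp ∘ r ∘ c) (comp ∘ x ∘ c))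
    , det≢0⇔isSpanningTree (quotientGraph P C) S c (λ i → elements-∈ S _) c-surjective)
    where
    c : Fin k → Fin q
    c = elements S ∘ cast (sym eq)

    c-surjective : ∀ {y} → y ∈ S → ∃[ i ] c i ≡ y
    c-surjective y∈S with elements-surjective S y∈S
    ... | i , refl = cast eq i , cong (elements S) (cast-involutive (sym eq) eq i)
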